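{- Let $G$ be a graph with at least two edges, $G\ne 2K_2$. Then for every positive integer $n$, $$\frac{2^{n-|V(G)|}}{|E(G)|-1}\le f(n,\mathcal{B}(G))\le 2^{n-1}.$$
   Context: $2K_2$ is the graph consisting of two disjoint edges. For a graph $G$, a hypergraph $H$ is a Berge-$G$ hypergraph if there are an injective map $\phi:V(G)\to V(H)$ and pairwise distinct hyperedges $e_{xy}\in E(H)$, one for each $xy\in E(G)$, with $\phi(x),\phi(y)\in e_{xy}$. $\mathcal{B}(G)$ denotes the family of all Berge-$G$ hypergraphs. For a positive integer $n$ and a graph $G$, $f(n,\mathcal{B}(G))$ is the smallest number of colors in a coloring of all subsets of $[n]=\{1,\dots,n\}$ (i.e. of $2^{[n]}$) such that there is no monochromatic Berge-$G$ hypergraph, i.e. no color class, viewed as a (non-uniform) hypergraph on $[n]$, contains a Berge-$G$ subhypergraph.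
   Formalization: The hypothesis G ≠ 2K_2 is strengthened to: G is not 2K_2 together with any number of isolated vertices, since for such G (e.g. 2K_2 plus one isolated vertex, n = 6, where f ≥ 42 > 32) the upper bound fails. -}

module Defs where

open import Data.Fin using (Fin; toℕ; _<?_)
import Data.Fin.Properties as Fin
open import Data.Fin.Subset using (Subset; _∈_)
open import Data.Integer using (ℤ; +_; -[1+_])
open import Data.List using (List; length; filter; allFin; cartesianProduct; lookup)
open import Data.Nat using (ℕ; suc; _≤_; _^_; _/_)
import Data.Nat.Properties as ℕ
open import Data.Product using (_×_; _,_; proj₁; proj₂; Σ-syntax; ∃-syntax)
open import Data.Rational using (ℚ) renaming (_/_ to _/ℚ_)
open import Function.Definitions using (Injective)
open import Level using (0ℓ)
open import Relation.Binary using (Rel; Symmetric; Decidable)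
open import Relation.Binary.PropositionalEquality using (_≡_; _≢_; refl; sym)
open import Relation.Nullary using (¬_; ¬?; _×-dec_)
open import Relation.Unary using (Pred; _⊆_)

-- Finite simple graphs, with vertex set Fin ∣V∣.
record Graph : Set₁ where
  field
    ∣V∣       : ℕ
    _~_       : Rel (Fin ∣V∣) 0ℓ
    _~?_      : Decidable _~_
    ~-sym     : Symmetric _~_
    ~-irrefl  : ∀ {x} → ¬ (x ~ x)

  -- Each edge {x , y} is listed once, as the pair (x , y) with x < y.
  edges : List (Fin ∣V∣ × Fin ∣V∣)
  edges = filter (λ (x , y) → (x <? y) ×-dec (x ~? y))
                 (cartesianProduct (allFin ∣V∣) (allFin ∣V∣))

  ∣E∣ : ℕ
  ∣E∣ = length edges

open Graph public using (∣V∣; ∣E∣; edges)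

-- The edges are {0 , 1} and {2 , 3}.
2K₂ : Graph
2K₂ = record
  { ∣V∣      = 4
  ; _~_      = λ x y → x ≢ y × toℕ x / 2 ≡ toℕ y / 2
  ; _~?_     = λ x y → ¬? (x Fin.≟ y) ×-dec ((toℕ x / 2) ℕ.≟ (toℕ y / 2))
  ; ~-sym    = λ (x≢y , eq) → (λ y≡x → x≢y (sym y≡x)) , sym eq
  ; ~-irrefl = λ (x≢x , _) → x≢x refl
  }

-- G is isomorphic to H with some number (possibly zero) of isolated
-- vertices added.  Isolated vertices matter for 2K₂: adding one to it gives a
-- graph with f(6) > 2⁵, so excluding 2K₂ alone would not suffice for the upper
-- bound.
_≅_+isolated : Graph → Graph → Set
G ≅ H +isolated =
  Σ[ φ ∈ (Fin (∣V∣ H) → Fin (∣V∣ G)) ]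
    Injective _≡_ _≡_ φ
  × (∀ x y → x ~ᴴ y → φ x ~ᴳ φ y)
  × (∀ u w → u ~ᴳ w → ∃[ x ] ∃[ y ] (x ~ᴴ y × φ x ≡ u × φ y ≡ w))
  where
  open Graph G using () renaming (_~_ to _~ᴳ_)
  open Graph H using () renaming (_~_ to _~ᴴ_)

Hypergraph : ℕ → Set₁
Hypergraph n = Pred (Subset n) 0ℓ

-- Hyperedges are indexed by positions in the edge list of G, so that
-- injectivity of e says that the chosen hyperedges are pairwise distinct.
IsBerge : ∀ {n} → Graph → Hypergraph n → Set
IsBerge {n} G H =
  Σ[ φ ∈ (Fin (∣V∣ G) → Fin n) ]
  Σ[ e ∈ (Fin (∣E∣ G) → Subset n) ]
    Injective _≡_ _≡_ φ
  × Injective _≡_ _≡_ e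
  × (∀ i → H (e i))
  × (∀ i → φ (proj₁ (lookup (edges G) i)) ∈ e i
         × φ (proj₂ (lookup (edges G) i)) ∈ e i)

ContainsBerge : ∀ {n} → Graph → Hypergraph n → Set₁
ContainsBerge {n} G H = Σ[ H′ ∈ Hypergraph n ] (H′ ⊆ H × IsBerge G H′)

Coloring : ℕ → ℕ → Set
Coloring n k = Subset n → Fin k

colorClass : ∀ {n k} → Coloring n k → Fin k → Hypergraph n
colorClass c i A = c A ≡ i

Colorable : ℕ → Graph → ℕ → Set₁
Colorable n G k =
  Σ[ c ∈ Coloring n k ] (∀ i → ¬ ContainsBerge G (colorClass c i))

-- m is the value f(n, 𝓑(G)).
f⟨_,𝓑_⟩≡_ : ℕ → Graph → ℕ → Set₁
f⟨ n ,𝓑 G ⟩≡ m = Colorable n G m × (∀ k → Colorable n G k → m ≤ k)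

2^ᶻ_ : ℤ → ℚ
2^ᶻ (+ k)    = + (2 ^ k) /ℚ 1
2^ᶻ -[1+ k ] = (+ 1 /ℚ (2 ^ suc k)) {{ℕ.m^n≢0 2 (suc k)}}

{-# OPTIONS --safe #-}

-- Upper bound: give every set the same color as its complement and nothing
-- else.  A color class then has only two hyperedges, so it contains a Berge-G
-- only if G has exactly two edges, and as these hyperedges are disjoint, so are
-- the edges of G: that is 2K₂ up to isolated vertices.
--
-- Lower bound: any ∣E∣ sets containing the first ∣V∣ points form a Berge-G, so
-- each color is used at most ∣E∣ - 1 times on the 2 ^ (n - ∣V∣) such sets.
--
-- A least number of colors exists constructively because colorability is
-- decidable: all quantifiers range over functions between finite types.

module Submission where

open import Defs
import Data.Bool.Properties as Bool
open import Data.Integer using (+_; _-_; -[1+_])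
import Data.Integer as ℤ
import Data.Integer.Properties as ℤ
open import Data.Nat using (ℕ; _∸_; _^_; _≤_; >-nonZero; zero; suc; s≤s; z≤n; _<_; _+_; NonZero)
import Data.Nat as ℕ
import Data.Nat.Properties as ℕ
open import Data.Nat.Properties using (m<n⇒0<n∸m)
open import Data.Product using (_×_; ∃-syntax; ∃; _,_; proj₁; proj₂)
open import Data.Product.Function.NonDependent.Propositional using (_×-↔_)
open import Data.Rational using (_/_; _*_; toℚᵘ) renaming (_≤_ to _≤ℚ_)
import Data.Rational.Properties as ℚ
import Data.Rational.Unnormalised as ℚᵘ
import Data.Rational.Unnormalised.Properties as ℚᵘ
open import Data.Empty using (⊥)
open import Data.Fin using (Fin; zero; suc; finToFun; funToFin; inject≤; _↑ˡ_)
open import Data.Fin.Patterns using (0F; 1F; 2F; 3F)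
import Data.Fin as Fin
import Data.Fin.Properties as Fin
open import Data.Fin.Subset using (Subset; Side; inside; outside; ∁; _∈_)
open import Data.Fin.Subset.Properties using (_∈?_; x∈∁p⇒x∉p)
open import Data.List using (List; []; _∷_; length; filter; lookup; allFin; cartesianProduct)
import Data.List.Membership.Propositional as List
open import Data.List.Membership.Propositional.Properties
  using (∈-filter⁺; ∈-filter⁻; ∈-cartesianProduct⁺; ∈-allFin; ∈-lookup)
open import Data.List.Properties using (length-tabulate)
open import Data.List.Relation.Unary.All as All using (All; []; _∷_)
import Data.List.Relation.Unary.All.Properties as All
open import Data.List.Relation.Unary.Any using (here; there)
open import Data.List.Relation.Unary.AllPairs using ([]; _∷_)
open import Data.List.Relation.Unary.Unique.Propositional using (Unique)
import Data.List.Relation.Unary.Unique.Propositional.Properties as Unique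
open import Data.Vec using ([]; _∷_; replicate; _++_)
import Data.Vec.Properties as Vec
open import Function using (_∘_; _↔_; mk↔ₛ′; id)
open import Function.Bundles using (module Injection; module Inverse)
open import Function.Construct.Composition using (_↔-∘_)
open import Function.Construct.Identity using (↔-id)
open import Function.Construct.Symmetry using (↔-sym)
open import Function.Definitions using (Injective)
open import Function.Properties.Inverse using (↔⇒↣)
open import Relation.Binary using (_Respects_; DecidableEquality; tri<; tri≈; tri>)
open import Relation.Binary.PropositionalEquality
  using (_≡_; _≢_; _≗_; refl; sym; trans; cong; cong₂; subst; subst₂; module ≡-Reasoning)
open import Relation.Nullary using (¬_; Dec; yes; no; ¬?; contradiction; _×-dec_; _→-dec_; map′)
open import Relation.Unary using (Decidable)

-- Least witnesses and decidability of colorability.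

-- The search tests `0` and then shifts `P` by one; the known witness `b` bounds its length. The
-- component `m ≤ b` later gives the upper bound on the number of colors.
least : ∀ {ℓ} {P : ℕ → Set ℓ} → Decidable P → ∀ b → P b →
        ∃[ m ] (P m × (∀ k → P k → m ≤ k) × m ≤ b)
least P? zero Pb = zero , Pb , (λ _ _ → z≤n) , z≤n
least {P = P} P? (suc b) Pb with P? zero
... | yes P0 = zero , P0 , (λ _ _ → z≤n) , z≤n
... | no ¬P0 with m , Pm , min , m≤b ← least (P? ∘ suc) b Pb =
  suc m , Pm , min′ , s≤s m≤b
  where
  min′ : ∀ k → P k → suc m ≤ k
  min′ zero    P0 = contradiction P0 ¬P0
  min′ (suc k) Pk = s≤s (min k Pk)

-- P must be extensional because f is only recovered from its code pointwise.
∃-function? : ∀ {A B : Set} {a b} → A ↔ Fin a → B ↔ Fin b →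
              {P : (A → B) → Set} → P Respects _≗_ → Decidable P → Dec (∃ P)
∃-function? {A} {B} {a} {b} A↔ B↔ {P} resp P? =
  map′ (λ (k , p) → decode k , p)
       (λ (f , p) → encode f , resp (λ x → sym (decode-encode f x)) p)
       (Fin.any? (P? ∘ decode))
  where
  module A = Inverse A↔
  module B = Inverse B↔

  decode : Fin (b ^ a) → A → B
  decode k x = B.from (finToFun k (A.to x))

  encode : (A → B) → Fin (b ^ a)
  encode f = funToFin (B.to ∘ f ∘ A.from)

  decode-encode : ∀ f → decode (encode f) ≗ f
  decode-encode f x = begin
    decode (encode f) x              ≡⟨ cong B.from (Fin.finToFun-funToFin (B.to ∘ f ∘ A.from) (A.to x)) ⟩
    B.from (B.to (f (A.from (A.to x)))) ≡⟨ B.strictlyInverseʳ _ ⟩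
    f (A.from (A.to x))              ≡⟨ cong f (A.strictlyInverseʳ x) ⟩
    f x                              ∎
    where open ≡-Reasoning

subset↔Fin : ∀ n → Subset n ↔ Fin (2 ^ n)
subset↔Fin zero    = mk↔ₛ′ (λ _ → zero) (λ _ → []) (λ { zero → refl }) (λ { [] → refl })
subset↔Fin (suc n) = ↔-sym Fin.*↔× ↔-∘ ((↔-sym Fin.2↔Bool ×-↔ subset↔Fin n) ↔-∘ cons)
  where
  cons : Subset (suc n) ↔ (Side × Subset n)
  cons = mk↔ₛ′ (λ { (x ∷ A) → x , A }) (λ (x , A) → x ∷ A) (λ _ → refl) (λ { (_ ∷ _) → refl })

subset-≟ : ∀ {n} → DecidableEquality (Subset n)
subset-≟ = Vec.≡-dec Bool._≟_

injective-resp : ∀ {m} {B : Set} → (λ (f : Fin m → B) → Injective _≡_ _≡_ f) Respects _≗_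
injective-resp f≗g inj eq = inj (trans (f≗g _) (trans eq (sym (f≗g _))))

injective? : ∀ {m} {B : Set} → DecidableEquality B → Decidable (λ (f : Fin m → B) → Injective _≡_ _≡_ f)
injective? _≟_ f = map′ (λ inj {x} {y} → inj x y) (λ inj x y → inj)
  (Fin.all? λ x → Fin.all? λ y → (f x ≟ f y) →-dec (x Fin.≟ y))

isBerge? : ∀ {n} G {H : Hypergraph n} → Decidable H → Dec (IsBerge G H)
isBerge? {n} G {H} H? =
  ∃-function? (↔-id _) (↔-id _)
    (λ {φ} φ≗ψ (e , φ-inj , e-inj , col , inc) →
      e , injective-resp φ≗ψ φ-inj , e-inj , col ,
      λ i → subst (_∈ e i) (φ≗ψ _) (proj₁ (inc i)) , subst (_∈ e i) (φ≗ψ _) (proj₂ (inc i)))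
    λ φ → ∃-function? (↔-id _) (subset↔Fin n)
      (λ e≗e′ (φ-inj , e-inj , col , inc) →
        φ-inj , injective-resp e≗e′ e-inj , (λ i → subst H (e≗e′ i) (col i)) ,
        λ i → subst (_ ∈_) (e≗e′ i) (proj₁ (inc i)) , subst (_ ∈_) (e≗e′ i) (proj₂ (inc i)))
      λ e → injective? Fin._≟_ φ ×-dec injective? subset-≟ e ×-dec
            Fin.all? (λ i → H? (e i)) ×-dec
            Fin.all? (λ i → (_ ∈? e i) ×-dec (_ ∈? e i))

isBerge-⊆ : ∀ {n G} {H H′ : Hypergraph n} → (∀ A → H A → H′ A) → IsBerge G H → IsBerge G H′
isBerge-⊆ H⊆H′ (φ , e , φ-inj , e-inj , col , inc) = φ , e , φ-inj , e-inj , (λ i → H⊆H′ (e i) (col i)) , inc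

-- The subhypergraphs in `ContainsBerge` range over a large type and cannot be enumerated. As
-- `IsBerge` is monotone in the hypergraph, it is enough to test each whole color class.
colorable? : ∀ n G k → Dec (Colorable n G k)
colorable? n G k =
  map′ (λ (c , ok) → c , λ i (_ , H′⊆ , b) → ok i (isBerge-⊆ {G = G} (λ A → H′⊆ {A}) b))
       (λ (c , ok) → c , λ i b → ok i (_ , id , b))
       (∃-function? (subset↔Fin n) (↔-id _)
         (λ c≗c′ ok i b → ok i (isBerge-⊆ {G = G} (λ A → trans (c≗c′ A)) b))
         (λ c → Fin.all? λ i → ¬? (isBerge? G (λ A → c A Fin.≟ i))))

-- Upper bound: pairs of complementary sets.

-- Exactly one of a set and its complement omits the first point. That one represents the pair, with
-- its first coordinate dropped.
fold : ∀ {n} → Subset (suc n) → Subset n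
fold (outside ∷ A) = A
fold (inside  ∷ A) = ∁ A

∁-involutive : ∀ {n} (A : Subset n) → ∁ (∁ A) ≡ A
∁-involutive []      = refl
∁-involutive (x ∷ A) = cong₂ _∷_ (Bool.not-involutive x) (∁-involutive A)

-- Two sets that agree at the first point and have equal folds coincide. So the first coordinates
-- differ, and the remaining ones are complementary.
fold-fibre : ∀ {n} (A B : Subset (suc n)) → fold A ≡ fold B → A ≢ B → B ≡ ∁ A
fold-fibre (outside ∷ A) (outside ∷ B) eq A≢B = contradiction (cong (outside ∷_) eq) A≢B
fold-fibre (outside ∷ A) (inside  ∷ B) eq A≢B =
  cong (inside ∷_) (trans (sym (∁-involutive B)) (cong ∁ (sym eq)))
fold-fibre (inside  ∷ A) (outside ∷ B) eq A≢B = cong (outside ∷_) (sym eq)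
fold-fibre (inside  ∷ A) (inside  ∷ B) eq A≢B =
  contradiction (cong (inside ∷_) (trans (sym (∁-involutive A)) (trans (cong ∁ eq) (∁-involutive B)))) A≢B

edge-complete : ∀ G {u w} → u Fin.< w → Graph._~_ G u w → (u , w) List.∈ edges G
edge-complete G {u} {w} u<w u~w =
  ∈-filter⁺ _ (∈-cartesianProduct⁺ (∈-allFin u) (∈-allFin w)) (u<w , u~w)

edge-sound : ∀ G {p} → p List.∈ edges G → Graph._~_ G (proj₁ p) (proj₂ p)
edge-sound G p∈ = proj₂ (proj₂ (∈-filter⁻ (λ (x , y) → (x Fin.<? y) ×-dec (Graph._~?_ G x y))
                    {xs = cartesianProduct (allFin _) (allFin _)} p∈))

-- The embedding sends `0, 1, 2, 3` to `a, b, c, d`. The hypotheses separate the two edges, and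
-- irreflexivity separates the ends of each. Every adjacency comes from a listed edge, so all other
-- vertices are isolated.
≅2K₂+isolated : ∀ G {a b c d} → edges G ≡ (a , b) ∷ (c , d) ∷ [] →
                a ≢ c → a ≢ d → b ≢ c → b ≢ d → G ≅ 2K₂ +isolated
≅2K₂+isolated G {a} {b} {c} {d} eq a≢c a≢d b≢c b≢d = φ , inj , pres , lift
  where
  open Graph G using (_~_; ~-sym; ~-irrefl)

  a~b : a ~ b
  a~b = edge-sound G (subst (_ List.∈_) (sym eq) (here refl))
  c~d : c ~ d
  c~d = edge-sound G (subst (_ List.∈_) (sym eq) (there (here refl)))

  distinct : ∀ {x y} → x ~ y → x ≢ y
  distinct x~x refl = ~-irrefl x~x

  φ : Fin 4 → Fin (∣V∣ G)
  φ 0F = a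
  φ 1F = b
  φ 2F = c
  φ 3F = d

  inj : Injective _≡_ _≡_ φ
  inj {0F} {0F} _ = refl
  inj {0F} {1F} e = contradiction e (distinct a~b)
  inj {0F} {2F} e = contradiction e a≢c
  inj {0F} {3F} e = contradiction e a≢d
  inj {1F} {0F} e = contradiction (sym e) (distinct a~b)
  inj {1F} {1F} _ = refl
  inj {1F} {2F} e = contradiction e b≢c
  inj {1F} {3F} e = contradiction e b≢d
  inj {2F} {0F} e = contradiction (sym e) a≢c
  inj {2F} {1F} e = contradiction (sym e) b≢c
  inj {2F} {2F} _ = refl
  inj {2F} {3F} e = contradiction e (distinct c~d)
  inj {3F} {0F} e = contradiction (sym e) a≢d
  inj {3F} {1F} e = contradiction (sym e) b≢d
  inj {3F} {2F} e = contradiction (sym e) (distinct c~d)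
  inj {3F} {3F} _ = refl

  pres : ∀ x y → Graph._~_ 2K₂ x y → φ x ~ φ y
  pres 0F 0F (x≢x , _) = contradiction refl x≢x
  pres 0F 1F _ = a~b
  -- The halves `toℕ x / 2` are `0` on the first pair of vertices and `1` on the second.
  pres 0F 2F (_ , ())
  pres 0F 3F (_ , ())
  pres 1F 0F _ = ~-sym a~b
  pres 1F 1F (x≢x , _) = contradiction refl x≢x
  pres 1F 2F (_ , ())
  pres 1F 3F (_ , ())
  pres 2F 2F (x≢x , _) = contradiction refl x≢x
  pres 2F 3F _ = c~d
  pres 3F 2F _ = ~-sym c~d
  pres 3F 3F (x≢x , _) = contradiction refl x≢x

  Image : Fin (∣V∣ G) → Fin (∣V∣ G) → Set
  Image u w = ∃[ x ] ∃[ y ] (Graph._~_ 2K₂ x y × φ x ≡ u × φ y ≡ w)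

  listed : ∀ {u w} → (u , w) List.∈ ((a , b) ∷ (c , d) ∷ []) → Image u w
  listed (here refl)         = 0F , 1F , ((λ ()) , refl) , refl , refl
  listed (there (here refl)) = 2F , 3F , ((λ ()) , refl) , refl , refl

  swap : ∀ {u w} → Image u w → Image w u
  swap (x , y , x~y , p , q) = y , x , Graph.~-sym 2K₂ {x} {y} x~y , q , p

  lift : ∀ u w → u ~ w → Image u w
  -- An edge is listed only with its smaller end first, so the other orientation is reached by
  -- `swap`.
  lift u w u~w with Fin.<-cmp u w
  ... | tri< u<w _ _  = listed (subst (_ List.∈_) eq (edge-complete G u<w u~w))
  ... | tri≈ _ refl _ = contradiction u~w ~-irrefl
  ... | tri> _ _ w<u  = swap (listed (subst (_ List.∈_) eq (edge-complete G w<u (~-sym u~w))))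

complement-colorable : ∀ G → 2 ≤ ∣E∣ G → ¬ (G ≅ 2K₂ +isolated) → ∀ m → Colorable (suc m) G (2 ^ m)
complement-colorable G 2≤∣E∣ G≇ m = color , no-mono
  where
  color : Coloring (suc m) (2 ^ m)
  color A = Inverse.to (subset↔Fin m) (fold A)

  partner : ∀ {i A B} → color A ≡ i → color B ≡ i → A ≢ B → B ≡ ∁ A
  partner {A = A} {B} cA cB = fold-fibre A B (Injection.injective (↔⇒↣ (subset↔Fin m)) (trans cA (sym cB)))

  no-mono : ∀ i → ¬ ContainsBerge G (colorClass color i)
  no-mono i (H′ , H′⊆ , φ , e , φ-inj , e-inj , col , inc) =
    -- The edge list is generalized to a variable `es`, so that matching on it also refines the
    -- index type of `e`.
    go (edges G) refl 2≤∣E∣ e e-inj (H′⊆ ∘ col) inc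
    where
    go : ∀ es → edges G ≡ es → 2 ≤ length es → (e : Fin (length es) → Subset (suc m)) →
         Injective _≡_ _≡_ e → (∀ j → color (e j) ≡ i) →
         (∀ j → φ (proj₁ (lookup es j)) ∈ e j × φ (proj₂ (lookup es j)) ∈ e j) → ⊥
    go [] _ ()
    go (_ ∷ []) _ (s≤s ())
    -- With three edges, `e 1F` and `e 2F` would both be the complement of `e 0F`.
    go (_ ∷ _ ∷ _ ∷ _) _ _ e e-inj col _
      with () ← e-inj {1F} {2F} (trans (partner (col 0F) (col 1F) λ p → Fin.0≢1+n (e-inj p))
                                 (sym (partner (col 0F) (col 2F) λ p → Fin.0≢1+n (e-inj p))))
    go (_ ∷ _ ∷ []) eq _ e e-inj col inc =
      G≇ (≅2K₂+isolated G eq (apart a∈ c∈) (apart a∈ d∈) (apart b∈ c∈) (apart b∈ d∈))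
      where
      a∈ = proj₁ (inc 0F)
      b∈ = proj₂ (inc 0F)
      c∈ = proj₁ (inc 1F)
      d∈ = proj₂ (inc 1F)

      e₁≡∁e₀ : e 1F ≡ ∁ (e 0F)
      e₁≡∁e₀ = partner (col 0F) (col 1F) λ p → Fin.0≢1+n (e-inj p)

      -- A vertex common to both edges would be mapped into a set and its complement.
      apart : ∀ {x y} → φ x ∈ e 0F → φ y ∈ e 1F → x ≢ y
      apart x∈ y∈ refl = x∈∁p⇒x∉p (subst (_ ∈_) e₁≡∁e₀ y∈) x∈

-- Lower bound: counting the sets of each color.

lookup-injective : ∀ {A : Set} {xs : List A} → Unique xs → Injective _≡_ _≡_ (lookup xs)
lookup-injective (_ ∷ _)   {zero}  {zero}  _  = refl
lookup-injective (x∉ ∷ _)  {zero}  {suc j} eq = contradiction eq (All.lookup x∉ (∈-lookup j))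
lookup-injective (x∉ ∷ _)  {suc i} {zero}  eq = contradiction (sym eq) (All.lookup x∉ (∈-lookup i))
lookup-injective (_ ∷ xs!) {suc i} {suc j} eq = cong suc (lookup-injective xs! eq)

length-filter-split : ∀ {A : Set} {P : A → Set} (P? : Decidable P) xs →
                      length xs ≡ length (filter P? xs) + length (filter (¬? ∘ P?) xs)
length-filter-split P? [] = refl
length-filter-split P? (x ∷ xs) with P? x
... | yes _ = cong suc (length-filter-split P? xs)
... | no  _ = trans (cong suc (length-filter-split P? xs)) (sym (ℕ.+-suc _ _))

-- Pigeonhole principle, by induction on the number of colors: the elements of the largest color are
-- split off, and the others use one color fewer. Colors are natural numbers so that this descent
-- needs no change of type.
length≤colors*bound : ∀ {A : Set} (c : A → ℕ) {d} →
  (∀ i ys → Unique ys → All (λ y → c y ≡ i) ys → length ys ≤ d) →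
  ∀ k xs → Unique xs → All (λ x → c x < k) xs → length xs ≤ k ℕ.* d
length≤colors*bound c bound zero    []      _   _       = z≤n
length≤colors*bound c bound zero    (_ ∷ _) _   (() ∷ _)
length≤colors*bound c {d} bound (suc k) xs  xs! xs<1+k  = begin
  length xs                  ≡⟨ length-filter-split last? xs ⟩
  length (filter last? xs) + length others
    ≤⟨ ℕ.+-mono-≤ (bound k _ (Unique.filter⁺ last? xs!) (All.all-filter last? xs))
                  (length≤colors*bound c bound k others (Unique.filter⁺ (¬? ∘ last?) xs!)
                    (All.zipWith (λ (c<1+k , c≢k) → ℕ.≤∧≢⇒< (ℕ.s≤s⁻¹ c<1+k) c≢k)
                      (All.filter⁺ (¬? ∘ last?) xs<1+k , All.all-filter (¬? ∘ last?) xs))) ⟩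
  d + k ℕ.* d                ∎
  where
  open ℕ.≤-Reasoning
  last? = λ x → c x ℕ.≟ k
  others = filter (¬? ∘ last?) xs

-- The sets containing the first `∣V∣ G` points are indexed by their traces on the last `r` points.
-- Vertices embed by `_↑ˡ r` and lie in all these sets, so any assignment of them to edges satisfies
-- the incidences.
colors-bound : ∀ G → 1 ≤ ∣E∣ G → ∀ r k → Colorable (∣V∣ G + r) G k → 2 ^ r ≤ k ℕ.* (∣E∣ G ∸ 1)
colors-bound G 1≤∣E∣ r k (c , ok) =
  subst (_≤ k ℕ.* (∣E∣ G ∸ 1)) (length-tabulate {n = 2 ^ r} id)
    (length≤colors*bound (Fin.toℕ ∘ c ∘ superset) class-bound k (allFin _) (Unique.allFin⁺ _)
      (All.universal (λ x → Fin.toℕ<n (c (superset x))) _))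
  where
  superset : Fin (2 ^ r) → Subset (∣V∣ G + r)
  superset x = replicate (∣V∣ G) inside ++ Inverse.from (subset↔Fin r) x

  superset-injective : Injective _≡_ _≡_ superset
  superset-injective eq = Injection.injective (↔⇒↣ (↔-sym (subset↔Fin r)))
    (Vec.++-injectiveʳ (replicate (∣V∣ G) inside) _ eq)

  ∈superset : ∀ v x → v ↑ˡ r ∈ superset x
  ∈superset v x = Vec.lookup⇒[]= (v ↑ˡ r) (superset x)
    (trans (Vec.lookup-++ˡ (replicate (∣V∣ G) inside) _ v) (Vec.lookup-replicate v inside))

  class-bound : ∀ i ys → Unique ys → All (λ y → Fin.toℕ (c (superset y)) ≡ i) ys → length ys ≤ ∣E∣ G ∸ 1
  -- Exceeding `∣E∣ G ∸ 1` means reaching `1 + (∣E∣ G ∸ 1)`, which is `∣E∣ G` because there is an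
  -- edge.
  class-bound i ys ys! mono = ℕ.≮⇒≥ λ lt → many (subst (_≤ length ys) (ℕ.m+[n∸m]≡n 1≤∣E∣) lt)
    where
    many : ¬ (∣E∣ G ≤ length ys)
    -- Since `i` is only a natural number, the color in `Fin k` is read off from the hyperedge at
    -- position `0`.
    many ∣E∣≤ = ok (c (e (Fin.fromℕ< 1≤∣E∣)))
      (_ , id , (_↑ˡ r) , e , Fin.↑ˡ-injective r _ _ , e-inj ,
       (λ j → Fin.toℕ-injective (trans (color-e j) (sym (color-e _)))) ,
       λ j → ∈superset _ _ , ∈superset _ _)
      where
      e : Fin (∣E∣ G) → Subset (∣V∣ G + r)
      e j = superset (lookup ys (inject≤ j ∣E∣≤))

      e-inj : Injective _≡_ _≡_ e
      e-inj eq = Fin.inject≤-injective ∣E∣≤ ∣E∣≤ _ _ (lookup-injective ys! (superset-injective eq))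

      color-e : ∀ j → Fin.toℕ (c (e j)) ≡ i
      color-e j = All.lookup mono (∈-lookup _)

-- The full set already needs a color. This settles the lower bound when `n` is smaller than
-- `∣V∣ G`.
colors-positive : ∀ {n G k} → Colorable n G k → 1 ≤ k
colors-positive {k = zero}  (c , _) = contradiction (c (replicate _ inside)) Fin.¬Fin0
colors-positive {k = suc _} _       = s≤s z≤n

-- Lower bound in the rationals.

-- Cross-multiplication, carried out on unnormalised fractions, where numerators and denominators
-- are not reduced by a gcd.
fraction-≤ : ∀ a b p q f .{{_ : NonZero b}} .{{_ : NonZero q}} →
             a ℕ.* p ≤ f ℕ.* (b ℕ.* q) → (+ a / b) * (+ p / q) ≤ℚ (+ f / 1)
fraction-≤ a b@(suc b-1) p q@(suc q-1) f ap≤fbq = ℚ.toℚᵘ-cancel-≤ (begin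
  toℚᵘ ((+ a / b) * (+ p / q))          ≃⟨ ℚ.toℚᵘ-homo-* (+ a / b) (+ p / q) ⟩
  toℚᵘ (+ a / b) ℚᵘ.* toℚᵘ (+ p / q)    ≃⟨ ℚᵘ.*-cong (ℚ.toℚᵘ-fromℚᵘ (+ a ℚᵘ./ b)) (ℚ.toℚᵘ-fromℚᵘ (+ p ℚᵘ./ q)) ⟩
  (+ a ℚᵘ./ b) ℚᵘ.* (+ p ℚᵘ./ q)        ≤⟨ ℚᵘ.*≤* (subst₂ ℤ._≤_ lhs (ℤ.pos-* f (b ℕ.* q)) (ℤ.+≤+ ap≤fbq)) ⟩
  + f ℚᵘ./ 1                            ≃⟨ ℚ.toℚᵘ-fromℚᵘ (+ f ℚᵘ./ 1) ⟨
  toℚᵘ (+ f / 1)                        ∎)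
  where
  open ℚᵘ.≤-Reasoning
  lhs : + (a ℕ.* p) ≡ (+ a ℤ.* + p) ℤ.* (+ 1)
  lhs = trans (ℤ.pos-* a p) (sym (ℤ.*-identityʳ _))

lower-bound : ∀ G → 1 ≤ ∣E∣ G → .{{_ : NonZero (∣E∣ G ∸ 1)}} → ∀ n k → Colorable n G k →
              (2^ᶻ (+ n - + ∣V∣ G)) * (+ 1 / (∣E∣ G ∸ 1)) ≤ℚ (+ k / 1)
lower-bound G 1≤∣E∣ n k col with ∣V∣ G ℕ.≤? n
... | yes V≤n with r , refl ← ℕ.m≤n⇒∃[o]m+o≡n V≤n =
  subst (λ z → (2^ᶻ z) * (+ 1 / d) ≤ℚ (+ k / 1)) (sym exponent)
    (fraction-≤ (2 ^ r) 1 1 d k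
      (subst₂ _≤_ (sym (ℕ.*-identityʳ _)) (cong (k ℕ.*_) (sym (ℕ.*-identityˡ d)))
        (colors-bound G 1≤∣E∣ r k col)))
  where
  d = ∣E∣ G ∸ 1
  exponent : + (∣V∣ G + r) - + ∣V∣ G ≡ + r
  exponent = trans (ℤ.m-n≡m⊖n (∣V∣ G + r) (∣V∣ G))
    (trans (ℤ.⊖-≥ (ℕ.m≤m+n (∣V∣ G) r)) (cong +_ (ℕ.m+n∸m≡n (∣V∣ G) r)))
-- The exponent is `- (1 + o)`, matching the second clause of `2^ᶻ_`. The left side is then less
-- than `1`, so having at least one color suffices.
... | no V≰n with o , 1+n+o≡V ← ℕ.m≤n⇒∃[o]m+o≡n (ℕ.≰⇒> V≰n) =
  subst (λ z → (2^ᶻ z) * (+ 1 / d) ≤ℚ (+ k / 1)) (sym (exponent o 1+n+o≡V))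
    (fraction-≤ 1 (2 ^ suc o) 1 d k {{ℕ.m^n≢0 2 (suc o)}}
      (ℕ.*-mono-≤ (colors-positive {G = G} col) (ℕ.*-mono-≤ (ℕ.m^n>0 2 (suc o)) (ℕ.>-nonZero⁻¹ d))))
  where
  d = ∣E∣ G ∸ 1
  exponent : ∀ o → suc n + o ≡ ∣V∣ G → + n - + ∣V∣ G ≡ -[1+ o ]
  exponent o refl = trans (ℤ.m-n≡m⊖n n (suc n + o))
    (trans (ℤ.⊖-< (s≤s (ℕ.m≤m+n n o)))
      (cong (λ j → ℤ.- (+ j)) (trans (cong (_∸ n) (sym (ℕ.+-suc n o))) (ℕ.m+n∸m≡n n (suc o)))))

theorem3 : (G : Graph) → (2≤∣E∣ : 2 ≤ ∣E∣ G) → ¬ (G ≅ 2K₂ +isolated) →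
    (n : ℕ) → 1 ≤ n →
    ∃[ f ] ( (f⟨ n ,𝓑 G ⟩≡ f)
           × (2^ᶻ (+ n - + ∣V∣ G)) * (+ 1 / (∣E∣ G ∸ 1)) {{>-nonZero (m<n⇒0<n∸m 2≤∣E∣)}} ≤ℚ (+ f / 1)
           × f ≤ 2 ^ (n ∸ 1) )
theorem3 G 2≤∣E∣ G≇ n@(suc m) _
  -- The complement coloring ensures that the search ends, and also bounds its result by `2 ^ m`.
  with f , f-colorable , f-least , f≤2^m ←
         least (colorable? n G) (2 ^ m) (complement-colorable G 2≤∣E∣ G≇ m) =
  f , (f-colorable , f-least) ,
  lower-bound G (ℕ.<⇒≤ 2≤∣E∣) {{>-nonZero (m<n⇒0<n∸m 2≤∣E∣)}} n f f-colorable ,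
  f≤2^m
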